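{- Given patterns $p,p_1,\dots,p_n$, the pattern $p$ is subsumed by $\{p_1,\dots,p_n\}$ if and only if $\big(p\setminus(p_1+\cdots+p_n)\big)\downarrow_{\mathfrak{R}_{\setminus}}=\bot$.
   Context: Signature. $\mathcal{C}$ is a finite set of constructors with arities, containing at least one constant (so that ground constructor terms exist), $\mathcal{X}$ a countable set of variables, $\mathcal{T}(\mathcal{C},\mathcal{X})$ the set of terms over them, $\mathcal{T}(\mathcal{C})$ the ground terms. Tuples $\langle p_1,\dots,p_n\rangle$ are built with tuple symbols (one per arity). Extended patterns: $p::=x\in\mathcal{X}\mid c(p_1,\dots,p_n)\mid p_1+p_2\mid p_1\setminus p_2\mid\bot$ with $c\in\mathcal{C}$ ($+,\setminus,\bot$ are formal symbols; $\setminus$ binds tighter than $+$). All notions extend to tuples: $n$-tuples of extended patterns, and their combinations (at fixed arity) by $+,\setminus,\bot$, are also called extended patterns. All extended patterns are assumed linear: $p_1+p_2$ is linear if $p_1,p_2$ are; $c(p_1,\dots,p_n)$ (or a tuple) is linear if the $p_i$ are linear with disjoint variables; $p_1\setminus p_2$ is linear if $p_1,p_2$ are linear with disjoint variables (variables are renamed apart if necessary). Additive: contains no $\setminus$. Pure: contains no $\bot$. "Pattern" in the claim means (linear) extended pattern, all of the same kind (all plain, or all tuples of the same arity). Ground semantics: $[\![x]\!]=\mathcal{T}(\mathcal{C})$, $[\![c(p_1,\dots,p_n)]\!]=\{c(t_1,\dots,t_n)\mid t_i\in[\![p_i]\!]\}$ (likewise for tuples), $[\![p_1+p_2]\!]=[\![p_1]\!]\cup[\![p_2]\!]$,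 $[\![p_1\setminus p_2]\!]=[\![p_1]\!]\setminus[\![p_2]\!]$, $[\![\bot]\!]=\emptyset$. A pattern $p$ is subsumed by a set of patterns $P=\{p_1,\dots,p_n\}$ iff $[\![p]\!]\subseteq[\![P]\!]$, where $[\![P]\!]=\bigcup_{i=1}^n[\![p_i]\!]$. Rewriting system $\mathfrak{R}_{\setminus}$ (applied at any position of an extended pattern): here $v,v_i,w,w_i$ range over additive patterns, $t_i$ over pure additive patterns, $V$ over pattern variables; $z_i$ are freshly generated pattern variables; $f,g$ range over all constructors and tuple symbols, $h$ over constructors of positive arity and tuple symbols. (A1) $\bot+v\Rightarrow v$; (A2) $v+\bot\Rightarrow v$; (E1) $h(v_1,\dots,\bot,\dots,v_n)\Rightarrow\bot$; (S1) $h(v_1,\dots,v_i+w_i,\dots,v_n)\Rightarrow h(v_1,\dots,v_i,\dots,v_n)+h(v_1,\dots,w_i,\dots,v_n)$; (M1) $v\setminus V\Rightarrow\bot$; (M2) $v\setminus\bot\Rightarrow v$; (M3) $w\setminus(v_1+v_2)\Rightarrow(w\setminus v_1)\setminus v_2$; (M4) $V\setminus g(t_1,\dots,t_n)\Rightarrow\big(\sum_{c\in\mathcal{C}}c(z_1,\dots,z_m)\big)\setminus g(t_1,\dots,t_n)$ with $m$ the arity of $c$; (M5) $\bot\setminus f(v_1,\dots,v_n)\Rightarrow\bot$; (M6) $(v+w)\setminus f(v_1,\dots,v_n)\Rightarrow(v\setminus f(v_1,\dots,v_n))+(w\setminus f(v_1,\dots,v_n))$; (M7) $f(v_1,\dots,v_n)\setminus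 f(t_1,\dots,t_n)\Rightarrow f(v_1\setminus t_1,\dots,v_n)+\cdots+f(v_1,\dots,v_n\setminus t_n)$ (for a constant $c$: $c\setminus c\Rightarrow\bot$); (M8) $f(v_1,\dots,v_n)\setminus g(w_1,\dots,w_m)\Rightarrow f(v_1,\dots,v_n)$ if $f\neq g$. $p\downarrow_{\mathfrak{R}_{\setminus}}$ denotes the normal form of $p$ with respect to $\mathfrak{R}_{\setminus}$. -}

module Defs where

open import Data.Fin using (Fin; toℕ)
open import Data.List using (List; []; _∷_; [_]; _++_; map; allFin)
open import Data.List.Membership.Propositional using (_∉_)
open import Data.List.Relation.Binary.Disjoint.Propositional using (Disjoint)
open import Data.List.Relation.Unary.Any using (Any)
open import Data.Nat using (ℕ)
open import Data.Product using (_×_; ∃-syntax)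
open import Data.Unit using (⊤)
open import Data.Vec using (Vec; []; _∷_; lookup; tabulate; _[_]≔_)
open import Data.Vec.Relation.Unary.All using (All)
open import Data.Vec.Relation.Unary.AllPairs using (AllPairs)
open import Function.Definitions using (Injective)
open import Level using (0ℓ)
open import Relation.Binary.Construct.Closure.ReflexiveTransitive using (Star)
open import Relation.Binary.PropositionalEquality using (_≡_; _≢_)
open import Relation.Binary.Rewriting using (IsNormalForm)
open import Relation.Unary using (Pred; _∪_; _⊆_)
import Relation.Unary as Unary

record Signature : Set where
  field
    size     : ℕ
    ar       : Fin size → ℕ
    const    : Fin size
    ar-const : ar const ≡ 0

Var : Set
Var = ℕ

-- Plain patterns and n-tuples of patterns are treated uniformly: a tuple is
-- an application of the tuple symbol of arity n.
data Kind : Set where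
  plain : Kind
  tuple : ℕ → Kind

module Patterns (S : Signature) where
  open Signature S

  infix  4 _SubsumedBy_ _⊢_↦_ _⊢_⟶_ _⇒_ _⇒*_ _↓≡_
  infixl 6 _+_
  infixl 7 _∖_

  data Symbol : Kind → Set where
    con : Fin size → Symbol plain
    tup : ∀ n → Symbol (tuple n)

  arity : ∀ {k} → Symbol k → ℕ
  arity (con c) = ar c
  arity (tup n) = n

  data Ground : Kind → Set where
    app : ∀ {k} (f : Symbol k) → Vec (Ground plain) (arity f) → Ground k

  -- Variables stand for plain terms only; arguments of symbols are plain.
  data Pat : Kind → Set where
    var     : Var → Pat plain
    app     : ∀ {k} (f : Symbol k) → Vec (Pat plain) (arity f) → Pat k
    _+_ _∖_ : ∀ {k} → Pat k → Pat k → Pat k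
    bot     : ∀ {k} → Pat k

  -- p₁ + ⋯ + pₙ, the empty sum being bot (as in c ∖ c ⇒ bot for a constant c).
  sum : ∀ {k} → List (Pat k) → Pat k
  sum []           = bot
  sum (p ∷ [])     = p
  sum (p ∷ q ∷ ps) = p + sum (q ∷ ps)

  mutual
    ⟦_⟧ : ∀ {k} → Pat k → Pred (Ground k) 0ℓ
    ⟦ var x ⟧    = Unary.U
    ⟦ app f ps ⟧ = λ t → ∃[ ts ] (⟦ ps ⟧* ts × t ≡ app f ts)
    ⟦ p + q ⟧    = ⟦ p ⟧ ∪ ⟦ q ⟧
    ⟦ p ∖ q ⟧    = ⟦ p ⟧ Unary.∩ Unary.∁ ⟦ q ⟧
    ⟦ bot ⟧      = Unary.∅

    ⟦_⟧* : ∀ {n} → Vec (Pat plain) n → Pred (Vec (Ground plain) n) 0ℓ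
    ⟦ [] ⟧*     []       = ⊤
    ⟦ p ∷ ps ⟧* (t ∷ ts) = ⟦ p ⟧ t × ⟦ ps ⟧* ts

  _SubsumedBy_ : ∀ {k} → Pat k → List (Pat k) → Set
  p SubsumedBy ps = ⟦ p ⟧ ⊆ (λ t → Any (λ q → ⟦ q ⟧ t) ps)

  mutual
    vars : ∀ {k} → Pat k → List Var
    vars (var x)    = [ x ]
    vars (app f ps) = vars* ps
    vars (p + q)    = vars p ++ vars q
    vars (p ∖ q)    = vars p ++ vars q
    vars bot        = []

    vars* : ∀ {n} → Vec (Pat plain) n → List Var
    vars* []       = []
    vars* (p ∷ ps) = vars p ++ vars* ps

  DisjointVars : ∀ {k l} → Pat k → Pat l → Set
  DisjointVars p q = Disjoint (vars p) (vars q)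

  data Linear : ∀ {k} → Pat k → Set where
    var : ∀ {x} → Linear (var x)
    app : ∀ {k} {f : Symbol k} {ps} →
          All Linear ps → AllPairs DisjointVars ps → Linear (app f ps)
    _+_ : ∀ {k} {p q : Pat k} → Linear p → Linear q → Linear (p + q)
    sub : ∀ {k} {p q : Pat k} →
          Linear p → Linear q → DisjointVars p q → Linear (p ∖ q)
    bot : ∀ {k} → Linear (bot {k})

  data Additive : ∀ {k} → Pat k → Set where
    var : ∀ {x} → Additive (var x)
    app : ∀ {k} {f : Symbol k} {ps} → All Additive ps → Additive (app f ps)
    _+_ : ∀ {k} {p q : Pat k} → Additive p → Additive q → Additive (p + q)
    bot : ∀ {k} → Additive (bot {k})

  data Pure : ∀ {k} → Pat k → Set where
    var : ∀ {x} → Pure (var x)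
    app : ∀ {k} {f : Symbol k} {ps} → All Pure ps → Pure (app f ps)
    _+_ : ∀ {k} {p q : Pat k} → Pure p → Pure q → Pure (p + q)
    _∖_ : ∀ {k} {p q : Pat k} → Pure p → Pure q → Pure (p ∖ q)

  mutual
    rename : ∀ {k} → (Var → Var) → Pat k → Pat k
    rename ρ (var x)    = var (ρ x)
    rename ρ (app f ps) = app f (rename* ρ ps)
    rename ρ (p + q)    = rename ρ p + rename ρ q
    rename ρ (p ∖ q)    = rename ρ p ∖ rename ρ q
    rename ρ bot        = bot

    rename* : ∀ {n} → (Var → Var) → Vec (Pat plain) n → Vec (Pat plain) n
    rename* ρ []       = []
    rename* ρ (p ∷ ps) = rename ρ p ∷ rename* ρ ps

  Variant : ∀ {k} → Pat k → Pat k → Set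
  Variant p q = ∃[ ρ ] (Injective _≡_ _≡_ ρ × q ≡ rename ρ p)

  -- ∑_c c(z₁,…,zₘ), with m the arity of c; the zᵢ are shared across summands.
  expand : (ℕ → Var) → Pat plain
  expand z = sum (map (λ c → app (con c) (tabulate (λ i → var (z (toℕ i)))))
                      (allFin size))

  -- Γ lists the variables that freshly generated ones must avoid.  Positions
  -- in argument vectors are given by an index i: vs [ i ]≔ p replaces the
  -- argument there.
  data _⊢_↦_ (Γ : List Var) : ∀ {k} → Pat k → Pat k → Set where
    A1 : ∀ {k} {v : Pat k} → Additive v → Γ ⊢ bot + v ↦ v

    A2 : ∀ {k} {v : Pat k} → Additive v → Γ ⊢ v + bot ↦ v

    E1 : ∀ {k} {h : Symbol k} {vs} i →
         All Additive vs → lookup vs i ≡ bot →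
         Γ ⊢ app h vs ↦ bot

    S1 : ∀ {k} {h : Symbol k} {vs} i {vᵢ wᵢ} →
         All Additive vs → lookup vs i ≡ vᵢ + wᵢ →
         Γ ⊢ app h vs ↦ app h (vs [ i ]≔ vᵢ) + app h (vs [ i ]≔ wᵢ)

    M1 : ∀ {v x} → Additive v → Γ ⊢ v ∖ var x ↦ bot

    M2 : ∀ {k} {v : Pat k} → Additive v → Γ ⊢ v ∖ bot ↦ v

    -- v₁ and v₂ may share variables, in which case (w ∖ v₁) ∖ v₂ is linear
    -- only after renaming v₂ apart; v₂′ may be v₂ itself when it need not be.
    M3 : ∀ {k} {w v₁ v₂ v₂′ : Pat k} →
         Additive w → Additive v₁ → Additive v₂ → Variant v₂ v₂′ →
         Γ ⊢ w ∖ (v₁ + v₂) ↦ w ∖ v₁ ∖ v₂′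

    M4 : ∀ {x g ts} (z : ℕ → Var) →
         Injective _≡_ _≡_ z → (∀ i → z i ∉ Γ) →
         All Additive ts → All Pure ts →
         Γ ⊢ var x ∖ app g ts ↦ expand z ∖ app g ts

    M5 : ∀ {k} {f : Symbol k} {vs} → All Additive vs →
         Γ ⊢ bot ∖ app f vs ↦ bot

    M6 : ∀ {k} {v w : Pat k} {f vs} →
         Additive v → Additive w → All Additive vs →
         Γ ⊢ (v + w) ∖ app f vs ↦ v ∖ app f vs + w ∖ app f vs

    M7 : ∀ {k} {f : Symbol k} {vs ts} →
         All Additive vs → All Additive ts → All Pure ts →
         Γ ⊢ app f vs ∖ app f ts ↦
             sum (map (λ i → app f (vs [ i ]≔ lookup vs i ∖ lookup ts i))
                      (allFin (arity f)))

    M8 : ∀ {k} {f g : Symbol k} {vs ws} →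
         All Additive vs → All Additive ws → f ≢ g →
         Γ ⊢ app f vs ∖ app g ws ↦ app f vs

  data _⊢_⟶_ (Γ : List Var) : ∀ {k} → Pat k → Pat k → Set where
    root : ∀ {k} {p q : Pat k} → Γ ⊢ p ↦ q → Γ ⊢ p ⟶ q
    arg  : ∀ {k} {f : Symbol k} {ps} i {q} → Γ ⊢ lookup ps i ⟶ q →
           Γ ⊢ app f ps ⟶ app f (ps [ i ]≔ q)
    +ˡ   : ∀ {k} {p p′ q : Pat k} → Γ ⊢ p ⟶ p′ → Γ ⊢ p + q ⟶ p′ + q
    +ʳ   : ∀ {k} {p q q′ : Pat k} → Γ ⊢ q ⟶ q′ → Γ ⊢ p + q ⟶ p + q′
    ∖ˡ   : ∀ {k} {p p′ q : Pat k} → Γ ⊢ p ⟶ p′ → Γ ⊢ p ∖ q ⟶ p′ ∖ q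
    ∖ʳ   : ∀ {k} {p q q′ : Pat k} → Γ ⊢ q ⟶ q′ → Γ ⊢ p ∖ q ⟶ p ∖ q′

  -- Freshness is relative to the whole pattern being rewritten.  Only linear
  -- patterns are rewritten, and only to linear patterns.
  _⇒_ : ∀ {k} → Pat k → Pat k → Set
  p ⇒ q = Linear p × Linear q × vars p ⊢ p ⟶ q

  _⇒*_ : ∀ {k} → Pat k → Pat k → Set
  _⇒*_ = Star _⇒_

  -- r is the normal form of p.  Since sums are not taken modulo associativity
  -- and commutativity, nor patterns modulo renaming, uniqueness is up to
  -- syntactic equality; for r = bot nothing coarser is needed.
  _↓≡_ : ∀ {k} → Pat k → Pat k → Set
  p ↓≡ r = p ⇒* r × IsNormalForm _⇒_ r ×
           (∀ {s} → p ⇒* s → IsNormalForm _⇒_ s → s ≡ r)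

{-# OPTIONS --safe #-}
module Submission where

-- Every rule preserves the ground semantics, which is decidable, so subsumption
-- is emptiness of p ∖ (p₁ + ⋯ + pₙ).  Every linear pattern rewrites to ⊥ or to a
-- pure additive pattern; as the reduction sequence found for a normal form is
-- empty, every normal form is of this shape.  A pure additive pattern has a
-- ground instance, so the only such normal form with empty semantics is ⊥.

open import Defs
open import Data.Fin using (Fin; zero; suc; toℕ)
open import Data.Fin.Properties using (toℕ-injective) renaming (_≟_ to _≟ᶠ_)
open import Data.List using (List; []; _∷_; _++_; map; allFin)
open import Data.List.Extrema.Nat using (max; xs≤max)
open import Data.List.Membership.Propositional using (_∈_; _∉_; lose)
open import Data.List.Membership.Propositional.Properties
  using (∈-++⁺ˡ; ∈-++⁺ʳ; ∈-++⁻; ∈-allFin; ∈-map⁻)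
open import Data.List.Properties using (map-++)
open import Data.List.Relation.Binary.Disjoint.Propositional using (Disjoint)
open import Data.List.Relation.Binary.Subset.Propositional using () renaming (_⊆_ to _⊆ˡ_)
open import Data.List.Relation.Binary.Pointwise using (Pointwise; []; _∷_)
open import Data.List.Relation.Unary.All using (All; []; _∷_; universal)
import Data.List.Relation.Unary.All as List
import Data.List.Relation.Unary.All.Properties as List
open import Data.List.Relation.Unary.Any using (Any; here; there; satisfied)
open import Data.List.Relation.Unary.Any.Properties using (map⁺; map⁻)
import Data.Nat as ℕ
open import Data.Nat using (ℕ)
open import Data.Nat.Properties using (+-cancelˡ-≡; m+n≮m)
open import Data.Product using (_×_; _,_; proj₁; proj₂; ∃-syntax)
open import Data.Sum using (_⊎_; inj₁; inj₂; [_,_]′; map₂)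
open import Data.Unit using (tt)
open import Data.Vec using (Vec; []; _∷_; lookup; tabulate; _[_]≔_)
open import Data.Vec.Properties
  using ([]≔-lookup; []≔-idempotent; lookup∘updateAt; lookup∘tabulate)
open import Data.Vec.Relation.Unary.All using ([]; _∷_) renaming (All to Allᵛ)
import Data.Vec.Relation.Unary.All as Vec
import Data.Vec.Relation.Unary.All.Properties as Vec
open import Data.Vec.Relation.Unary.AllPairs using (AllPairs; []; _∷_)
import Data.Vec.Relation.Unary.AllPairs.Properties as AllPairs
open import Function using (_∘_; id)
open import Function.Bundles using (_⇔_; mk⇔)
open import Function.Properties.Equivalence using () renaming (sym to ⇔-sym; trans to ⇔-trans)
open import Function.Definitions using (Injective)
open import Relation.Binary.Construct.Closure.ReflexiveTransitive using (Star; ε; _◅_)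
import Relation.Binary.Construct.Closure.ReflexiveTransitive as Star
open import Relation.Binary.PropositionalEquality
  using (_≡_; refl; sym; trans; cong; cong₂; subst)
open import Relation.Binary.Rewriting using (IsNormalForm)
open import Relation.Nullary using (¬_; Dec; yes; no; contradiction)
open import Relation.Nullary.Decidable using (map′; _×-dec_; _⊎-dec_; ¬?; decidable-stable)
open import Relation.Unary using (_≐_; _⊆_; Decidable; Satisfiable; Empty)
open import Relation.Unary.Algebra using (∪-cong)
open import Relation.Unary.Properties using (≐-trans)

-- Soundness of rewriting; instances of pure additive patterns

module Semantics (S : Signature) where
  open Signature S
  open Patterns S

  _≟_ : ∀ {k} (f g : Symbol k) → Dec (f ≡ g)
  con c ≟ con d = map′ (cong con) (λ { refl → refl }) (c ≟ᶠ d)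
  tup n ≟ tup n = yes refl

  mutual
    -- Decidability replaces classical reasoning in two places: finding the argument at which a
    -- vector of patterns fails to match, and removing a double negation when a difference is empty.
    ⟦_⟧? : ∀ {k} (p : Pat k) → Decidable ⟦ p ⟧
    ⟦ var x ⟧?    t = yes tt
    ⟦ app f ps ⟧? (app g ts) with f ≟ g
    ... | no f≢g = no λ { (_ , _ , refl) → f≢g refl }
    ... | yes refl = map′ (λ h → ts , h , refl) (λ { (_ , h , refl) → h }) (⟦ ps ⟧*? ts)
    ⟦ p + q ⟧?    t = ⟦ p ⟧? t ⊎-dec ⟦ q ⟧? t
    ⟦ p ∖ q ⟧?    t = ⟦ p ⟧? t ×-dec ¬? (⟦ q ⟧? t)
    ⟦ bot ⟧?      t = no λ ()

    ⟦_⟧*? : ∀ {n} (ps : Vec (Pat plain) n) → Decidable ⟦ ps ⟧*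
    ⟦ [] ⟧*?     []       = yes tt
    ⟦ p ∷ ps ⟧*? (t ∷ ts) = ⟦ p ⟧? t ×-dec ⟦ ps ⟧*? ts

  ⟦⟧*-lookup : ∀ {n} (ps : Vec (Pat plain) n) i {ts} →
               ⟦ ps ⟧* ts → ⟦ lookup ps i ⟧ (lookup ts i)
  ⟦⟧*-lookup (p ∷ ps) zero    {t ∷ ts} (h , _)  = h
  ⟦⟧*-lookup (p ∷ ps) (suc i) {t ∷ ts} (_ , hs) = ⟦⟧*-lookup ps i hs

  ⟦⟧*-∉ : ∀ {n} (ps : Vec (Pat plain) n) {ts} → ¬ ⟦ ps ⟧* ts →
          ∃[ i ] ¬ ⟦ lookup ps i ⟧ (lookup ts i)
  ⟦⟧*-∉ []       {[]}     h = contradiction tt h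
  ⟦⟧*-∉ (p ∷ ps) {t ∷ ts} h with ⟦ p ⟧? t
  ... | no ¬p = zero , ¬p
  ... | yes tp with ⟦⟧*-∉ ps (λ tps → h (tp , tps))
  ...   | i , ¬pᵢ = suc i , ¬pᵢ

  -- The hypothesis already speaks of an updated vector, so one induction covers both inserting a
  -- pattern and putting the original back: updating at `i` with the entry at `i` changes nothing.
  ⟦⟧*-replace : ∀ {n} (ps : Vec (Pat plain) n) i {p q ts} →
                ⟦ ps [ i ]≔ p ⟧* ts → ⟦ q ⟧ (lookup ts i) → ⟦ ps [ i ]≔ q ⟧* ts
  ⟦⟧*-replace (_ ∷ ps) zero    {ts = t ∷ ts} (_ , hs) h = h , hs
  ⟦⟧*-replace (_ ∷ ps) (suc i) {ts = t ∷ ts} (h₀ , hs) h = h₀ , ⟦⟧*-replace ps i hs h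

  module _ {n} (ps : Vec (Pat plain) n) (i : Fin n) {q : Pat plain} {ts : Vec (Ground plain) n} where

    ⟦⟧*-put : ⟦ ps ⟧* ts → ⟦ q ⟧ (lookup ts i) → ⟦ ps [ i ]≔ q ⟧* ts
    ⟦⟧*-put h = ⟦⟧*-replace ps i (subst (λ ps → ⟦ ps ⟧* ts) (sym ([]≔-lookup ps i)) h)

    ⟦⟧*-get : ⟦ ps [ i ]≔ q ⟧* ts → ⟦ q ⟧ (lookup ts i)
    ⟦⟧*-get h = subst (λ p → ⟦ p ⟧ (lookup ts i)) (lookup∘updateAt i ps)
                      (⟦⟧*-lookup (ps [ i ]≔ q) i h)

    ⟦⟧*-restore : ⟦ ps [ i ]≔ q ⟧* ts → ⟦ lookup ps i ⟧ (lookup ts i) → ⟦ ps ⟧* ts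
    ⟦⟧*-restore h hᵢ = subst (λ ps → ⟦ ps ⟧* ts) ([]≔-lookup ps i) (⟦⟧*-replace ps i h hᵢ)

  module _ {k} {t : Ground k} where

    ⟦sum⟧⁺ : ∀ ps → Any (λ p → ⟦ p ⟧ t) ps → ⟦ sum ps ⟧ t
    ⟦sum⟧⁺ (p ∷ [])     (here h)  = h
    ⟦sum⟧⁺ (p ∷ q ∷ ps) (here h)  = inj₁ h
    ⟦sum⟧⁺ (p ∷ q ∷ ps) (there h) = inj₂ (⟦sum⟧⁺ (q ∷ ps) h)

    ⟦sum⟧⁻ : ∀ ps → ⟦ sum ps ⟧ t → Any (λ p → ⟦ p ⟧ t) ps
    ⟦sum⟧⁻ (p ∷ [])     h        = here h
    ⟦sum⟧⁻ (p ∷ q ∷ ps) (inj₁ h) = here h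
    ⟦sum⟧⁻ (p ∷ q ∷ ps) (inj₂ h) = there (⟦sum⟧⁻ (q ∷ ps) h)

  mutual
    -- Every variable denotes all ground terms, whatever its name. The two inclusions are proved
    -- together because a difference reverses inclusion in its right operand.
    ⟦rename⟧⁺ : ∀ {k} ρ (p : Pat k) → ⟦ p ⟧ ⊆ ⟦ rename ρ p ⟧
    ⟦rename⟧⁺ ρ (var x)    h            = tt
    ⟦rename⟧⁺ ρ (app f ps) (ts , h , e) = ts , ⟦rename⟧*⁺ ρ ps h , e
    ⟦rename⟧⁺ ρ (p + q)    (inj₁ h)     = inj₁ (⟦rename⟧⁺ ρ p h)
    ⟦rename⟧⁺ ρ (p + q)    (inj₂ h)     = inj₂ (⟦rename⟧⁺ ρ q h)
    ⟦rename⟧⁺ ρ (p ∖ q)    (h , ¬h)     = ⟦rename⟧⁺ ρ p h , ¬h ∘ ⟦rename⟧⁻ ρ q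

    ⟦rename⟧⁻ : ∀ {k} ρ (p : Pat k) → ⟦ rename ρ p ⟧ ⊆ ⟦ p ⟧
    ⟦rename⟧⁻ ρ (var x)    h            = tt
    ⟦rename⟧⁻ ρ (app f ps) (ts , h , e) = ts , ⟦rename⟧*⁻ ρ ps h , e
    ⟦rename⟧⁻ ρ (p + q)    (inj₁ h)     = inj₁ (⟦rename⟧⁻ ρ p h)
    ⟦rename⟧⁻ ρ (p + q)    (inj₂ h)     = inj₂ (⟦rename⟧⁻ ρ q h)
    ⟦rename⟧⁻ ρ (p ∖ q)    (h , ¬h)     = ⟦rename⟧⁻ ρ p h , ¬h ∘ ⟦rename⟧⁺ ρ q

    ⟦rename⟧*⁺ : ∀ {n} ρ (ps : Vec (Pat plain) n) → ⟦ ps ⟧* ⊆ ⟦ rename* ρ ps ⟧*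
    ⟦rename⟧*⁺ ρ []       {[]}    _        = tt
    ⟦rename⟧*⁺ ρ (p ∷ ps) {_ ∷ _} (h , hs) = ⟦rename⟧⁺ ρ p h , ⟦rename⟧*⁺ ρ ps hs

    ⟦rename⟧*⁻ : ∀ {n} ρ (ps : Vec (Pat plain) n) → ⟦ rename* ρ ps ⟧* ⊆ ⟦ ps ⟧*
    ⟦rename⟧*⁻ ρ []       {[]}    _        = tt
    ⟦rename⟧*⁻ ρ (p ∷ ps) {_ ∷ _} (h , hs) = ⟦rename⟧⁻ ρ p h , ⟦rename⟧*⁻ ρ ps hs

  ⟦variant⟧ : ∀ {k} {p q : Pat k} → Variant p q → ⟦ p ⟧ ≐ ⟦ q ⟧
  ⟦variant⟧ {p = p} (ρ , _ , refl) = ⟦rename⟧⁺ ρ p , ⟦rename⟧⁻ ρ p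

  module _ {k} {t : Ground k} where

    Any-variant⁺ : ∀ {ps qs} → Pointwise Variant ps qs →
                   Any (λ p → ⟦ p ⟧ t) ps → Any (λ q → ⟦ q ⟧ t) qs
    Any-variant⁺ (v ∷ vs) (here h)  = here (proj₁ (⟦variant⟧ v) h)
    Any-variant⁺ (v ∷ vs) (there h) = there (Any-variant⁺ vs h)

    Any-variant⁻ : ∀ {ps qs} → Pointwise Variant ps qs →
                   Any (λ q → ⟦ q ⟧ t) qs → Any (λ p → ⟦ p ⟧ t) ps
    Any-variant⁻ (v ∷ vs) (here h)  = here (proj₂ (⟦variant⟧ v) h)
    Any-variant⁻ (v ∷ vs) (there h) = there (Any-variant⁻ vs h)

  -- The head constructor of the ground term selects the summand, whose arguments are variables and
  -- hence match anything.
  ⟦expand⟧ : ∀ z (t : Ground plain) → ⟦ expand z ⟧ t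
  ⟦expand⟧ z (app (con c) ts) =
    ⟦sum⟧⁺ _ (map⁺ (lose (∈-allFin c) (ts , vars-all toℕ ts , refl)))
    where
    -- Stated for any `g` rather than `toℕ`: the tail of a tabulated vector composes its function
    -- with `suc`.
    vars-all : ∀ {n} (g : Fin n → ℕ) ts → ⟦ tabulate (λ i → var (z (g i))) ⟧* ts
    vars-all g []       = tt
    vars-all g (t ∷ ts) = tt , vars-all (g ∘ suc) ts

  ∖-cong : ∀ {k} {p p′ q q′ : Pat k} → ⟦ p ⟧ ≐ ⟦ p′ ⟧ → ⟦ q ⟧ ≐ ⟦ q′ ⟧ →
           ⟦ p ∖ q ⟧ ≐ ⟦ p′ ∖ q′ ⟧
  ∖-cong (to , from) (to′ , from′) =
    (λ (h , ¬h) → to h , ¬h ∘ from′) , (λ (h , ¬h) → from h , ¬h ∘ to′)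

  module _ {Γ : List Var} where

    ↦-sound : ∀ {k} {p q : Pat k} → Γ ⊢ p ↦ q → ⟦ p ⟧ ≐ ⟦ q ⟧
    ↦-sound (A1 _) = [ (λ ()) , id ]′ , inj₂
    ↦-sound (A2 _) = [ id , (λ ()) ]′ , inj₁
    ↦-sound (E1 {vs = vs} i _ eq) =
      (λ (ts , h , _) → subst (λ p → ⟦ p ⟧ (lookup ts i)) eq (⟦⟧*-lookup vs i h)) , λ ()
    ↦-sound (S1 {h = h} {vs = vs} i {v} {w} _ eq) = to , from
      where
      to : ⟦ app h vs ⟧ ⊆ ⟦ app h (vs [ i ]≔ v) + app h (vs [ i ]≔ w) ⟧
      to (ts , hs , refl)
        with subst (λ p → ⟦ p ⟧ (lookup ts i)) eq (⟦⟧*-lookup vs i hs)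
      ... | inj₁ hᵢ = inj₁ (ts , ⟦⟧*-put vs i hs hᵢ , refl)
      ... | inj₂ hᵢ = inj₂ (ts , ⟦⟧*-put vs i hs hᵢ , refl)
      -- `inj` places either summand inside `v + w`, which by `eq` is the original argument at `i`.
      restore : ∀ {p ts} → (⟦ p ⟧ ⊆ ⟦ v + w ⟧) → ⟦ vs [ i ]≔ p ⟧* ts → ⟦ vs ⟧* ts
      restore {ts = ts} inj hs =
        ⟦⟧*-restore vs i hs
          (subst (λ p → ⟦ p ⟧ (lookup ts i)) (sym eq) (inj (⟦⟧*-get vs i hs)))
      from : ⟦ app h (vs [ i ]≔ v) + app h (vs [ i ]≔ w) ⟧ ⊆ ⟦ app h vs ⟧
      from (inj₁ (ts , hs , e)) = ts , restore {v} inj₁ hs , e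
      from (inj₂ (ts , hs , e)) = ts , restore {w} inj₂ hs , e
    ↦-sound (M1 _) = (λ (_ , ¬h) → ¬h tt) , λ ()
    ↦-sound (M2 _) = proj₁ , λ h → h , λ ()
    ↦-sound (M3 _ _ _ v₂≈v₂′) =
      (λ (h , ¬h) → (h , ¬h ∘ inj₁) , ¬h ∘ inj₂ ∘ proj₂ (⟦variant⟧ v₂≈v₂′)) ,
      (λ ((h , ¬h₁) , ¬h₂) → h , [ ¬h₁ , ¬h₂ ∘ proj₁ (⟦variant⟧ v₂≈v₂′) ]′)
    ↦-sound (M4 z _ _ _ _) = (λ (_ , ¬h) → ⟦expand⟧ z _ , ¬h) , (λ (_ , ¬h) → tt , ¬h)
    ↦-sound (M5 _) = proj₁ , λ ()
    ↦-sound (M6 _ _ _) =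
      (λ { (inj₁ h , ¬h) → inj₁ (h , ¬h) ; (inj₂ h , ¬h) → inj₂ (h , ¬h) }) ,
      (λ { (inj₁ (h , ¬h)) → inj₁ h , ¬h ; (inj₂ (h , ¬h)) → inj₂ h , ¬h })
    ↦-sound (M7 {f = f} {vs} {us} _ _ _) = to , from
      where
      part : Fin (arity f) → Pat _
      part i = app f (vs [ i ]≔ lookup vs i ∖ lookup us i)
      to : ⟦ app f vs ∖ app f us ⟧ ⊆ ⟦ sum (map part (allFin (arity f))) ⟧
      -- A vector outside a product of patterns misses some factor; the index of that factor selects
      -- the summand.
      to ((ts , h , refl) , ¬h) with ⟦⟧*-∉ us (λ hu → ¬h (ts , hu , refl))
      ... | i , ¬hᵢ =
        ⟦sum⟧⁺ _ (map⁺ (lose (∈-allFin i)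
          (ts , ⟦⟧*-put vs i h (⟦⟧*-lookup vs i h , ¬hᵢ) , refl)))
      from : ⟦ sum (map part (allFin (arity f))) ⟧ ⊆ ⟦ app f vs ∖ app f us ⟧
      from {t} h with satisfied (map⁻ {P = λ p → ⟦ p ⟧ t}
                                      (⟦sum⟧⁻ (map part (allFin (arity f))) h))
      ... | i , ts , hs , refl with ⟦⟧*-get vs i hs
      ...   | hᵢ , ¬hᵢ =
        (ts , ⟦⟧*-restore vs i hs hᵢ , refl) , λ { (_ , hu , refl) → ¬hᵢ (⟦⟧*-lookup us i hu) }
    ↦-sound (M8 _ _ f≢g) =
      proj₁ , λ { (ts , h , refl) → (ts , h , refl) , λ { (_ , _ , refl) → f≢g refl } }

    ⟶-sound : ∀ {k} {p q : Pat k} → Γ ⊢ p ⟶ q → ⟦ p ⟧ ≐ ⟦ q ⟧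
    ⟶-sound (root r) = ↦-sound r
    ⟶-sound (arg {ps = ps} i s) with ⟶-sound s
    ... | to , from =
      (λ (ts , h , e) → ts , ⟦⟧*-put ps i h (to (⟦⟧*-lookup ps i h)) , e) ,
      (λ (ts , h , e) → ts , ⟦⟧*-restore ps i h (from (⟦⟧*-get ps i h)) , e)
    ⟶-sound (+ˡ s) = ∪-cong (⟶-sound s) (id , id)
    ⟶-sound (+ʳ s) = ∪-cong (id , id) (⟶-sound s)
    ⟶-sound (∖ˡ {p = p} {p′} {q} s) = ∖-cong {p = p} {p′} {q} {q} (⟶-sound s) (id , id)
    ⟶-sound (∖ʳ {p = p} {q} {q′} s) = ∖-cong {p = p} {p} {q} {q′} (id , id) (⟶-sound s)

  ⇒*-sound : ∀ {k} {p q : Pat k} → p ⇒* q → ⟦ p ⟧ ≐ ⟦ q ⟧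
  ⇒*-sound = Star.fold (λ p q → ⟦ p ⟧ ≐ ⟦ q ⟧)
                       (λ (_ , _ , s) → ≐-trans (⟶-sound s)) (id , id)

  -- Variables denote a nonempty set thanks to this term, built from the constant of the signature.
  ground : Ground plain
  ground = app (con const) (subst (Vec _) (sym ar-const) [])

  mutual
    -- Additivity excludes differences and purity excludes `bot`, so nothing can cut the semantics
    -- down to the empty set; for a sum, an instance of one summand is enough.
    inhabited : ∀ {k} {p : Pat k} → Additive p → Pure p → Satisfiable ⟦ p ⟧
    inhabited var     var      = ground , tt
    inhabited (app a) (app b)  with inhabited* a b
    ... | ts , h = app _ ts , ts , h , refl
    inhabited (a + _) (b + _)  with inhabited a b
    ... | t , h = t , inj₁ h

    inhabited* : ∀ {n} {ps : Vec (Pat plain) n} →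
                 Allᵛ Additive ps → Allᵛ Pure ps → Satisfiable ⟦ ps ⟧*
    inhabited* []       []       = [] , tt
    inhabited* (a ∷ as) (b ∷ bs) with inhabited a b | inhabited* as bs
    ... | t , h | ts , hs = t ∷ ts , h , hs

-- Renaming and fresh variables

module Renaming (S : Signature) where
  open Patterns S

  mutual
    rename-id : ∀ {k} (p : Pat k) → rename id p ≡ p
    rename-id (var x)    = refl
    rename-id (app f ps) = cong (app f) (rename*-id ps)
    rename-id (p + q)    = cong₂ _+_ (rename-id p) (rename-id q)
    rename-id (p ∖ q)    = cong₂ _∖_ (rename-id p) (rename-id q)
    rename-id bot        = refl

    rename*-id : ∀ {n} (ps : Vec (Pat plain) n) → rename* id ps ≡ ps
    rename*-id []       = refl
    rename*-id (p ∷ ps) = cong₂ _∷_ (rename-id p) (rename*-id ps)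

  module _ (σ ρ : Var → Var) where
    mutual
      rename-∘ : ∀ {k} (p : Pat k) → rename (σ ∘ ρ) p ≡ rename σ (rename ρ p)
      rename-∘ (var x)    = refl
      rename-∘ (app f ps) = cong (app f) (rename*-∘ ps)
      rename-∘ (p + q)    = cong₂ _+_ (rename-∘ p) (rename-∘ q)
      rename-∘ (p ∖ q)    = cong₂ _∖_ (rename-∘ p) (rename-∘ q)
      rename-∘ bot        = refl

      rename*-∘ : ∀ {n} (ps : Vec (Pat plain) n) →
                  rename* (σ ∘ ρ) ps ≡ rename* σ (rename* ρ ps)
      rename*-∘ []       = refl
      rename*-∘ (p ∷ ps) = cong₂ _∷_ (rename-∘ p) (rename*-∘ ps)

  module _ (ρ : Var → Var) where
    mutual
      rename-additive : ∀ {k} {p : Pat k} → Additive p → Additive (rename ρ p)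
      rename-additive var     = var
      rename-additive (app a) = app (rename*-additive a)
      rename-additive (a + b) = rename-additive a + rename-additive b
      rename-additive bot     = bot

      rename*-additive : ∀ {n} {ps : Vec (Pat plain) n} →
                         Allᵛ Additive ps → Allᵛ Additive (rename* ρ ps)
      rename*-additive []       = []
      rename*-additive (a ∷ as) = rename-additive a ∷ rename*-additive as

    mutual
      rename-pure : ∀ {k} {p : Pat k} → Pure p → Pure (rename ρ p)
      rename-pure var     = var
      rename-pure (app a) = app (rename*-pure a)
      rename-pure (a + b) = rename-pure a + rename-pure b
      rename-pure (a ∖ b) = rename-pure a ∖ rename-pure b

      rename*-pure : ∀ {n} {ps : Vec (Pat plain) n} →
                     Allᵛ Pure ps → Allᵛ Pure (rename* ρ ps)
      rename*-pure []       = []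
      rename*-pure (a ∷ as) = rename-pure a ∷ rename*-pure as

    mutual
      vars-rename : ∀ {k} (p : Pat k) → vars (rename ρ p) ≡ map ρ (vars p)
      vars-rename (var x)    = refl
      vars-rename (app f ps) = vars*-rename ps
      vars-rename (p + q)    = trans (cong₂ _++_ (vars-rename p) (vars-rename q))
                                     (sym (map-++ ρ (vars p) (vars q)))
      vars-rename (p ∖ q)    = trans (cong₂ _++_ (vars-rename p) (vars-rename q))
                                     (sym (map-++ ρ (vars p) (vars q)))
      vars-rename bot        = refl

      vars*-rename : ∀ {n} (ps : Vec (Pat plain) n) →
                     vars* (rename* ρ ps) ≡ map ρ (vars* ps)
      vars*-rename []       = refl
      vars*-rename (p ∷ ps) = trans (cong₂ _++_ (vars-rename p) (vars*-rename ps))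
                                    (sym (map-++ ρ (vars p) (vars* ps)))

    ∈-vars-rename⁻ : ∀ {k x} (p : Pat k) → x ∈ vars (rename ρ p) →
                     ∃[ y ] (y ∈ vars p × x ≡ ρ y)
    ∈-vars-rename⁻ p = ∈-map⁻ ρ ∘ subst (_ ∈_) (vars-rename p)

    module _ (ρ-injective : Injective _≡_ _≡_ ρ) where

      rename-disjoint : ∀ {k l} (p : Pat k) (q : Pat l) → DisjointVars p q →
                        DisjointVars (rename ρ p) (rename ρ q)
      rename-disjoint p q p#q (x∈p , x∈q)
        with ∈-vars-rename⁻ p x∈p | ∈-vars-rename⁻ q x∈q
      ... | y , y∈p , refl | z , z∈q , eq with ρ-injective eq
      ...   | refl = p#q (y∈p , z∈q)

      mutual
        rename-linear : ∀ {k} {p : Pat k} → Linear p → Linear (rename ρ p)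
        rename-linear var         = var
        rename-linear (app l d)   = app (rename*-linear l) (rename*-disjoint d)
        rename-linear (l + m)     = rename-linear l + rename-linear m
        rename-linear (sub {p = p} {q} l m d) =
          sub (rename-linear l) (rename-linear m) (rename-disjoint p q d)
        rename-linear bot         = bot

        rename*-linear : ∀ {n} {ps : Vec (Pat plain) n} →
                         Allᵛ Linear ps → Allᵛ Linear (rename* ρ ps)
        rename*-linear []       = []
        rename*-linear (l ∷ ls) = rename-linear l ∷ rename*-linear ls

        rename*-disjoint : ∀ {n} {ps : Vec (Pat plain) n} →
                           AllPairs DisjointVars ps → AllPairs DisjointVars (rename* ρ ps)
        rename*-disjoint []                    = []
        rename*-disjoint {ps = p ∷ qs} (d ∷ ds) = go qs d ∷ rename*-disjoint ds
          where
          go : ∀ {n} (qs : Vec (Pat plain) n) → Allᵛ (DisjointVars p) qs →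
               Allᵛ (DisjointVars (rename ρ p)) (rename* ρ qs)
          go []       []       = []
          go (q ∷ qs) (d ∷ ds) = rename-disjoint p q d ∷ go qs ds

-- All values lie strictly above the maximum of `Γ`; `suc` keeps even the value at 0 out of `Γ`.
-- Being injective, the stream serves both as the variables `z` of M4 and as the renaming of M3.
fresh : List Var → ℕ → Var
fresh Γ n = ℕ.suc (max 0 Γ) ℕ.+ n

fresh-injective : ∀ Γ → Injective _≡_ _≡_ (fresh Γ)
fresh-injective Γ = +-cancelˡ-≡ (ℕ.suc (max 0 Γ)) _ _

fresh-∉ : ∀ Γ n → fresh Γ n ∉ Γ
fresh-∉ Γ n x∈Γ = m+n≮m (max 0 Γ) n (List.lookup (xs≤max 0 Γ) x∈Γ)

-- One-hole contexts and freshness relative to the surroundings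

module Contexts (S : Signature) where
  open Patterns S

  -- Only M4 looks at the avoided variables, and variables outside the larger list are outside the
  -- smaller one.
  weaken-↦ : ∀ {Γ Δ k} {p q : Pat k} → Γ ⊆ˡ Δ → Δ ⊢ p ↦ q → Γ ⊢ p ↦ q
  weaken-↦ Γ⊆Δ (A1 a)           = A1 a
  weaken-↦ Γ⊆Δ (A2 a)           = A2 a
  weaken-↦ Γ⊆Δ (E1 i a eq)      = E1 i a eq
  weaken-↦ Γ⊆Δ (S1 i a eq)      = S1 i a eq
  weaken-↦ Γ⊆Δ (M1 a)           = M1 a
  weaken-↦ Γ⊆Δ (M2 a)           = M2 a
  weaken-↦ Γ⊆Δ (M3 a b c v)     = M3 a b c v
  weaken-↦ Γ⊆Δ (M4 z inj z∉ a b) = M4 z inj (λ i → z∉ i ∘ Γ⊆Δ) a b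
  weaken-↦ Γ⊆Δ (M5 a)           = M5 a
  weaken-↦ Γ⊆Δ (M6 a b c)       = M6 a b c
  weaken-↦ Γ⊆Δ (M7 a b c)       = M7 a b c
  weaken-↦ Γ⊆Δ (M8 a b f≢g)     = M8 a b f≢g

  weaken : ∀ {Γ Δ k} {p q : Pat k} → Γ ⊆ˡ Δ → Δ ⊢ p ⟶ q → Γ ⊢ p ⟶ q
  weaken Γ⊆Δ (root r)  = root (weaken-↦ Γ⊆Δ r)
  weaken Γ⊆Δ (arg i s) = arg i (weaken Γ⊆Δ s)
  weaken Γ⊆Δ (+ˡ s)    = +ˡ (weaken Γ⊆Δ s)
  weaken Γ⊆Δ (+ʳ s)    = +ʳ (weaken Γ⊆Δ s)
  weaken Γ⊆Δ (∖ˡ s)    = ∖ˡ (weaken Γ⊆Δ s)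
  weaken Γ⊆Δ (∖ʳ s)    = ∖ʳ (weaken Γ⊆Δ s)

  -- Whatever a rewrite of `p` adds must lie outside `Γ`, the variables around the hole; this
  -- preserves disjointness, and so linearity, of the whole pattern.
  _⊢_avoids_ : ∀ {k l} → List Var → Pat k → Pat l → Set
  Γ ⊢ q avoids p = ∀ {x} → x ∈ Γ → x ∈ vars q → x ∈ vars p

  -- Plugging bot into a one-hole context leaves exactly the variables of the
  -- context itself.
  record Context {k l} (C : Pat k → Pat l) : Set where
    field
      step  : ∀ {Γ p q} → Γ ⊢ p ⟶ q → Γ ⊢ C p ⟶ C q
      vars⁻ : ∀ {x p} → x ∈ vars (C p) → x ∈ vars p ⊎ x ∈ vars (C bot)
      vars⁺ : ∀ {x p} → x ∈ vars p ⊎ x ∈ vars (C bot) → x ∈ vars (C p)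
      plug  : ∀ {p q} → Linear (C p) → Linear q → vars (C bot) ⊢ q avoids p →
              Linear (C q)

  open Context public

  +ˡ-context : ∀ {k} {q : Pat k} → Context (_+ q)
  +ˡ-context = record
    { step  = +ˡ
    ; vars⁻ = ∈-++⁻ _
    ; vars⁺ = [ ∈-++⁺ˡ , ∈-++⁺ʳ _ ]′
    ; plug  = λ { (_ + m) l _ → l + m }
    }

  -- For `plug`: a variable shared by the new left operand and `q` is, by `av`, already shared by
  -- the old one, which linearity of the old difference forbids.
  ∖ˡ-context : ∀ {k} {q : Pat k} → Context (_∖ q)
  ∖ˡ-context = record
    { step  = ∖ˡ
    ; vars⁻ = ∈-++⁻ _
    ; vars⁺ = [ ∈-++⁺ˡ , ∈-++⁺ʳ _ ]′
    ; plug  = λ { (sub _ m d) l av → sub l m λ (x∈p , x∈q) → d (av x∈q x∈p , x∈q) }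
    }

  +ʳ-context : ∀ {k} {p : Pat k} → Context (p +_)
  +ʳ-context {p = p} = record
    { step  = +ʳ
    ; vars⁻ = [ inj₂ ∘ ∈-++⁺ˡ , inj₁ ]′ ∘ ∈-++⁻ (vars p)
    ; vars⁺ = [ ∈-++⁺ʳ (vars p) , [ ∈-++⁺ˡ , (λ ()) ]′ ∘ ∈-++⁻ (vars p) ]′
    ; plug  = λ { (l + _) m _ → l + m }
    }

  ∖ʳ-context : ∀ {k} {p : Pat k} → Context (p ∖_)
  ∖ʳ-context {p = p} = record
    { step  = ∖ʳ
    ; vars⁻ = [ inj₂ ∘ ∈-++⁺ˡ , inj₁ ]′ ∘ ∈-++⁻ (vars p)
    ; vars⁺ = [ ∈-++⁺ʳ (vars p) , [ ∈-++⁺ˡ , (λ ()) ]′ ∘ ∈-++⁻ (vars p) ]′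
    ; plug  = λ { (sub l _ d) m av →
                  sub l m λ (x∈p , x∈q) → d (x∈p , av (∈-++⁺ˡ x∈p) x∈q) }
    }

  vars*-lookup⁺ : ∀ {n x} (ps : Vec (Pat plain) n) i → x ∈ vars (lookup ps i) → x ∈ vars* ps
  vars*-lookup⁺ (p ∷ ps) zero    = ∈-++⁺ˡ
  vars*-lookup⁺ (p ∷ ps) (suc i) = ∈-++⁺ʳ (vars p) ∘ vars*-lookup⁺ ps i

  vars*-lookup⁻ : ∀ {n x} (ps : Vec (Pat plain) n) → x ∈ vars* ps →
                  ∃[ i ] x ∈ vars (lookup ps i)
  vars*-lookup⁻ (p ∷ ps) x∈ with ∈-++⁻ (vars p) x∈
  ... | inj₁ x∈p  = zero , x∈p
  ... | inj₂ x∈ps with vars*-lookup⁻ ps x∈ps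
  ...   | i , x∈pᵢ = suc i , x∈pᵢ

  vars*-replace⁻ : ∀ {n x p} (ps : Vec (Pat plain) n) i →
                   x ∈ vars* (ps [ i ]≔ p) → x ∈ vars p ⊎ x ∈ vars* (ps [ i ]≔ bot)
  vars*-replace⁻ (_ ∷ ps) zero    = ∈-++⁻ _
  vars*-replace⁻ (p ∷ ps) (suc i) =
    [ inj₂ ∘ ∈-++⁺ˡ , map₂ (∈-++⁺ʳ (vars p)) ∘ vars*-replace⁻ ps i ]′ ∘ ∈-++⁻ (vars p)

  vars*-replace⁺ : ∀ {n x p} (ps : Vec (Pat plain) n) i →
                   x ∈ vars p ⊎ x ∈ vars* (ps [ i ]≔ bot) → x ∈ vars* (ps [ i ]≔ p)
  vars*-replace⁺ (_ ∷ ps) zero    (inj₁ x∈) = ∈-++⁺ˡ x∈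
  vars*-replace⁺ (_ ∷ ps) zero    (inj₂ x∈) = ∈-++⁺ʳ _ x∈
  vars*-replace⁺ (p ∷ ps) (suc i) (inj₁ x∈) = ∈-++⁺ʳ (vars p) (vars*-replace⁺ ps i (inj₁ x∈))
  vars*-replace⁺ (p ∷ ps) (suc i) (inj₂ x∈) with ∈-++⁻ (vars p) x∈
  ... | inj₁ x∈p  = ∈-++⁺ˡ x∈p
  ... | inj₂ x∈ps = ∈-++⁺ʳ (vars p) (vars*-replace⁺ ps i (inj₂ x∈ps))

  All-replace : ∀ {P : Pat plain → Set} {n p q} (ps : Vec (Pat plain) n) i →
                Allᵛ P (ps [ i ]≔ p) → P q → Allᵛ P (ps [ i ]≔ q)
  All-replace (_ ∷ ps) zero    (_ ∷ hs) h = h ∷ hs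
  All-replace (_ ∷ ps) (suc i) (g ∷ hs) h = g ∷ All-replace ps i hs h

  disjoint*⁺ : ∀ {n} (p : Pat plain) {qs : Vec (Pat plain) n} →
               Allᵛ (DisjointVars p) qs → Disjoint (vars p) (vars* qs)
  disjoint*⁺ p {qs} d (x∈p , x∈qs) with vars*-lookup⁻ qs x∈qs
  ... | i , x∈q = Vec.lookup⁺ d i (x∈p , x∈q)

  disjoint*⁻ : ∀ {n} (p : Pat plain) {qs : Vec (Pat plain) n} →
               Disjoint (vars p) (vars* qs) → Allᵛ (DisjointVars p) qs
  disjoint*⁻ p {qs} d = Vec.lookup⁻ λ i (x∈p , x∈q) → d (x∈p , vars*-lookup⁺ qs i x∈q)

  -- Only pairs involving position `i` change; there, a variable that the new argument shares with
  -- another is pulled back to the old argument.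
  disjoint-replace : ∀ {n p q} (ps : Vec (Pat plain) n) i →
                     AllPairs DisjointVars (ps [ i ]≔ p) →
                     (∀ {x} → x ∈ vars* (ps [ i ]≔ bot) → x ∈ vars q → x ∈ vars p) →
                     AllPairs DisjointVars (ps [ i ]≔ q)
  disjoint-replace {p = p} {q} (_ ∷ ps) zero (d ∷ ds) av =
    disjoint*⁻ q (λ (x∈q , x∈ps) → disjoint*⁺ p d (av x∈ps x∈q , x∈ps)) ∷ ds
  disjoint-replace {p = p} (o ∷ ps) (suc i) (d ∷ ds) av =
    All-replace ps i d
      (λ (x∈o , x∈q) → disjoint*⁺ o d (x∈o , vars*-replace⁺ ps i (inj₁ (av (∈-++⁺ˡ x∈o) x∈q)))) ∷
    disjoint-replace ps i ds (av ∘ ∈-++⁺ʳ (vars o))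

  arg-context : ∀ {k} (f : Symbol k) ps i → Context (λ p → app f (ps [ i ]≔ p))
  arg-context f ps i = record
    -- `arg` rewrites the entry found at `i` and then updates; on a vector already updated at `i`,
    -- the lookup gives `p` and the second update overwrites the first.
    { step  = λ {Γ} {p} {q} s →
        subst (λ qs → Γ ⊢ app f (ps [ i ]≔ p) ⟶ app f qs) ([]≔-idempotent ps i)
          (arg i (subst (λ r → Γ ⊢ r ⟶ q) (sym (lookup∘updateAt i ps)) s))
    ; vars⁻ = vars*-replace⁻ ps i
    ; vars⁺ = vars*-replace⁺ ps i
    ; plug  = λ { (app l d) m av → app (All-replace ps i l m) (disjoint-replace ps i d av) }
    }

  infix 4 _⊢_⇛_ _⊢_⇓

  -- A step below a context whose variables are Γ; any new variables of q are outside Γ.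
  _⊢_⇛_ : ∀ {k} → List Var → Pat k → Pat k → Set
  Γ ⊢ p ⇛ q = Linear q × (Γ ++ vars p ⊢ p ⟶ q) × Γ ⊢ q avoids p

  -- The step in the hole avoids `Γ` together with the variables around the hole, so what is new in
  -- the hole is new to the outside as well.
  lift : ∀ {Γ k l} {C : Pat k → Pat l} {p q} → Context C → Linear (C p) →
         Γ ++ vars (C bot) ⊢ p ⇛ q → Γ ⊢ C p ⇛ C q
  lift {Γ} {C = C} {p} {q} K lin (m , s , av) =
    plug K lin m (av ∘ ∈-++⁺ʳ Γ) , step K (weaken sub′ s) , av′
    where
    sub′ : Γ ++ vars (C p) ⊆ˡ (Γ ++ vars (C bot)) ++ vars p
    sub′ x∈ with ∈-++⁻ Γ x∈
    ... | inj₁ x∈Γ = ∈-++⁺ˡ (∈-++⁺ˡ x∈Γ)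
    ... | inj₂ x∈C with vars⁻ K x∈C
    ...   | inj₁ x∈p = ∈-++⁺ʳ (Γ ++ vars (C bot)) x∈p
    ...   | inj₂ x∈K = ∈-++⁺ˡ (∈-++⁺ʳ Γ x∈K)
    av′ : Γ ⊢ C q avoids C p
    av′ x∈Γ x∈C with vars⁻ K x∈C
    ... | inj₁ x∈q = vars⁺ K (inj₁ (av (∈-++⁺ˡ x∈Γ) x∈q))
    ... | inj₂ x∈K = vars⁺ K (inj₂ x∈K)

  -- Weaker than being in normal form: rule S1 may still apply.
  data Reduced {k} : Pat k → Set where
    bot  : Reduced bot
    pure : ∀ {p} → Additive p → Pure p → Reduced p

  _⊢_⇓ : ∀ {k} → List Var → Pat k → Set
  Γ ⊢ p ⇓ = ∃[ r ] (Star (Γ ⊢_⇛_) p r × Reduced r)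

  reduced⇓ : ∀ {Γ k} {p : Pat k} → Reduced p → Γ ⊢ p ⇓
  reduced⇓ r = _ , ε , r

  infixr 5 _◅⇓_
  _◅⇓_ : ∀ {Γ k} {p q : Pat k} → Γ ⊢ p ⇛ q → Γ ⊢ q ⇓ → Γ ⊢ p ⇓
  s ◅⇓ (r , ss , red) = r , s ◅ ss , red

  root-step : ∀ {Γ k} {p q : Pat k} → Linear q → Γ ++ vars p ⊢ p ↦ q →
              vars q ⊆ˡ vars p → Γ ⊢ p ⇛ q
  root-step m r q⊆p = m , root r , λ _ → q⊆p

  -- Reduces the content of the hole, then hands over to `continue`. Each lifted step brings the
  -- linearity of its result, which the next step and `continue` require.
  focus : ∀ {Γ k l} {C : Pat k → Pat l} {p} → Context C → Linear (C p) →
          Γ ++ vars (C bot) ⊢ p ⇓ →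
          (∀ {r} → Reduced r → Linear (C r) → Γ ⊢ C r ⇓) → Γ ⊢ C p ⇓
  focus {Γ} {C = C} K lin (_ , ss , red) continue = go lin ss
    where
    go : ∀ {p} → Linear (C p) → Star (Γ ++ vars (C bot) ⊢_⇛_) p _ → Γ ⊢ C p ⇓
    go lin ε        = continue red lin
    go lin (s ◅ ss) = let s′ = lift {Γ} K lin s in s′ ◅⇓ go (proj₁ s′) ss

-- Reducing every linear pattern to `bot` or a pure additive pattern

module Normalisation (S : Signature) where
  open Signature S
  open Patterns S
  open Semantics S using (_≟_)
  open Renaming S
  open Contexts S

  reduced-additive : ∀ {k} {p : Pat k} → Reduced p → Additive p
  reduced-additive bot        = bot
  reduced-additive (pure a _) = a

  -- Separates the two outcomes for an application: an argument `bot` lets E1 fire, and otherwise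
  -- the application is itself pure.
  pure-args : ∀ {n} {ps : Vec (Pat plain) n} → Allᵛ Reduced ps →
              (∃[ i ] lookup ps i ≡ bot) ⊎ Allᵛ Pure ps
  pure-args []              = inj₂ []
  pure-args (bot ∷ _)       = inj₁ (zero , refl)
  pure-args (pure _ b ∷ rs) with pure-args rs
  ... | inj₁ (i , eq) = inj₁ (suc i , eq)
  ... | inj₂ bs       = inj₂ (b ∷ bs)

  reduced-args : ∀ {n} {ps : Vec (Pat plain) n} →
                 Allᵛ Additive ps → Allᵛ Pure ps → Allᵛ Reduced ps
  reduced-args []       []       = []
  reduced-args (a ∷ as) (b ∷ bs) = pure a b ∷ reduced-args as bs

  app⇓ : ∀ {Γ k} {f : Symbol k} {ps} → Allᵛ Reduced ps → Γ ⊢ app f ps ⇓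
  app⇓ rs with pure-args rs
  ... | inj₁ (i , eq) =
    root-step bot (E1 i (Vec.map reduced-additive rs) eq) (λ ()) ◅⇓ reduced⇓ bot
  ... | inj₂ bs = reduced⇓ (pure (app (Vec.map reduced-additive rs)) (app bs))

  reduced+⇓ : ∀ {Γ k} {p q : Pat k} → Reduced p → Reduced q → Linear (p + q) → Γ ⊢ p + q ⇓
  reduced+⇓ bot s (_ + m) = root-step m (A1 (reduced-additive s)) id ◅⇓ reduced⇓ s
  reduced+⇓ r@(pure a _) bot (l + _) = root-step l (A2 a) ∈-++⁺ˡ ◅⇓ reduced⇓ r
  reduced+⇓ (pure a b) (pure c d) _ = reduced⇓ (pure (a + c) (b + d))

  -- The operands must reduce under every list of avoided variables, since focusing on one operand
  -- adds the variables of the other.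
  +⇓ : ∀ {Γ k} {p q : Pat k} → Linear (p + q) → (∀ {Δ} → Δ ⊢ p ⇓) → (∀ {Δ} → Δ ⊢ q ⇓) →
       Γ ⊢ p + q ⇓
  +⇓ lin p⇓ q⇓ = focus +ˡ-context lin p⇓ λ r lin → focus +ʳ-context lin q⇓ λ s → reduced+⇓ r s

  sum-linear : ∀ {k} {ps : List (Pat k)} → All Linear ps → Linear (sum ps)
  sum-linear []           = bot
  sum-linear (l ∷ [])     = l
  sum-linear (l ∷ m ∷ ls) = l + sum-linear (m ∷ ls)

  sum-additive : ∀ {k} {ps : List (Pat k)} → All Additive ps → Additive (sum ps)
  sum-additive []           = bot
  sum-additive (a ∷ [])     = a
  sum-additive (a ∷ b ∷ as) = a + sum-additive (b ∷ as)

  vars-sum⁻ : ∀ {k x} (ps : List (Pat k)) → x ∈ vars (sum ps) → Any (λ p → x ∈ vars p) ps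
  vars-sum⁻ (p ∷ [])     x∈ = here x∈
  vars-sum⁻ (p ∷ q ∷ ps) x∈ = [ here , there ∘ vars-sum⁻ (q ∷ ps) ]′ (∈-++⁻ (vars p) x∈)

  sum⇓ : ∀ {Γ k} {ps : List (Pat k)} → All Linear ps → All (λ p → ∀ {Δ} → Δ ⊢ p ⇓) ps →
         Γ ⊢ sum ps ⇓
  sum⇓ []           []            = reduced⇓ bot
  sum⇓ (l ∷ [])     (p⇓ ∷ [])     = p⇓
  sum⇓ (l ∷ m ∷ ls) (p⇓ ∷ q⇓ ∷ hs) =
    +⇓ (sum-linear (l ∷ m ∷ ls)) p⇓ (sum⇓ (m ∷ ls) (q⇓ ∷ hs))

  module _ {z : ℕ → Var} where
    private
      args : ∀ c → Vec (Pat plain) (ar c)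
      args c = tabulate (λ i → var (z (toℕ i)))

    -- Injectivity of `z` separates the arguments within one summand; across summands the variables
    -- are shared, which linearity of a sum permits.
    expand-linear : Injective _≡_ _≡_ z → Linear (expand z)
    expand-linear inj = sum-linear (List.map⁺ (universal
      (λ c → app (Vec.tabulate⁺ (λ _ → var))
                 (AllPairs.tabulate⁺ λ i≢j →
                    λ { (here refl , here eq) → i≢j (toℕ-injective (inj eq)) }))
      (allFin size)))

    expand-vars : ∀ {x} → x ∈ vars (expand z) → ∃[ i ] x ≡ z i
    expand-vars {x} x∈
      with satisfied (map⁻ {P = λ p → x ∈ vars p}
                           (vars-sum⁻ (map (λ c → app (con c) (args c)) (allFin size)) x∈))
    ... | c , x∈c with vars*-lookup⁻ (args c) x∈c
    ...   | i , x∈i with subst (λ p → x ∈ vars p) (lookup∘tabulate (λ i → var (z (toℕ i))) i) x∈i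
    ...     | here eq = toℕ i , eq

  -- The induction is on the subtrahend `t`, with the minuend arbitrary. M4 makes the minuend grow,
  -- but the M7 that may follow subtracts only the arguments of `t`, so the process ends.
  Subtractable : ∀ {k} → Pat k → Set
  Subtractable t = ∀ {Γ v} → Reduced v → Linear (v ∖ t) → Γ ⊢ v ∖ t ⇓

  module _ {k} {g : Symbol k} {us : Vec (Pat plain) (arity g)}
           (a : Allᵛ Additive us) (b : Allᵛ Pure us)
           (subtractable : Allᵛ Subtractable us) where
    private
      u : Pat k
      u = app g us

    bot∖⇓ : ∀ {Γ} → Γ ⊢ bot ∖ u ⇓
    bot∖⇓ = root-step bot (M5 a) (λ ()) ◅⇓ reduced⇓ bot

    +∖⇓ : ∀ {Γ v w} → Additive v → Additive w → Linear ((v + w) ∖ u) →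
          (∀ {Δ} → Linear (v ∖ u) → Δ ⊢ v ∖ u ⇓) →
          (∀ {Δ} → Linear (w ∖ u) → Δ ⊢ w ∖ u ⇓) → Γ ⊢ (v + w) ∖ u ⇓
    +∖⇓ {v = v} {w} av aw (sub (lv + lw) lu d) v⇓ w⇓ =
      root-step (lv∖u + lw∖u) (M6 av aw a)
        ([ [ ∈-++⁺ˡ ∘ ∈-++⁺ˡ , ∈-++⁺ʳ (vars (v + w)) ]′ ∘ ∈-++⁻ (vars v)
         , [ ∈-++⁺ˡ ∘ ∈-++⁺ʳ (vars v) , ∈-++⁺ʳ (vars (v + w)) ]′ ∘ ∈-++⁻ (vars w)
         ]′ ∘ ∈-++⁻ (vars (v ∖ u)))
      ◅⇓ +⇓ (lv∖u + lw∖u) (v⇓ lv∖u) (w⇓ lw∖u)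
      where
      lv∖u : Linear (v ∖ u)
      lv∖u = sub lv lu λ (x∈v , x∈u) → d (∈-++⁺ˡ x∈v , x∈u)
      lw∖u : Linear (w ∖ u)
      lw∖u = sub lw lu λ (x∈w , x∈u) → d (∈-++⁺ʳ (vars v) x∈w , x∈u)

    sum∖⇓ : ∀ {Γ vs} → All Additive vs →
            All (λ v → ∀ {Δ} → Linear (v ∖ u) → Δ ⊢ v ∖ u ⇓) vs →
            Linear (sum vs ∖ u) → Γ ⊢ sum vs ∖ u ⇓
    sum∖⇓ []            []            _   = bot∖⇓
    sum∖⇓ (_ ∷ [])      (h ∷ [])      lin = h lin
    sum∖⇓ (av ∷ aw ∷ as) (h ∷ h′ ∷ hs) lin =
      +∖⇓ av (sum-additive (aw ∷ as)) lin h (sum∖⇓ (aw ∷ as) (h′ ∷ hs))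

    -- Distinct heads are settled by M8. Equal heads give the M7 sum, whose summands carry one
    -- difference of arguments each, reduced by the hypothesis on `us`; E1 then removes a summand
    -- whose difference became `bot`.
    app∖⇓ : ∀ {Γ} (f : Symbol k) {vs} → Allᵛ Additive vs → Allᵛ Pure vs →
            Linear (app f vs ∖ u) → Γ ⊢ app f vs ∖ u ⇓
    app∖⇓ f av bv (sub lv lu d) with f ≟ g
    ... | no f≢g =
      root-step lv (M8 av a f≢g) ∈-++⁺ˡ ◅⇓ reduced⇓ (pure (app av) (app bv))
    app∖⇓ f {vs} av bv (sub lv (app lu _) d) | yes refl =
      root-step (sum-linear linear) (M7 av a b) vars⊆ ◅⇓
      sum⇓ linear (List.map⁺ (universal part⇓ (allFin (arity f))))
      where
      part : Fin (arity f) → Pat k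
      part i = app f (vs [ i ]≔ lookup vs i ∖ lookup us i)
      args-linear : Linear (app f vs) → ∀ i → Linear (lookup vs i)
      args-linear (app l _) = Vec.lookup⁺ l
      difference-linear : ∀ i → Linear (lookup vs i ∖ lookup us i)
      difference-linear i =
        sub (args-linear lv i) (Vec.lookup⁺ lu i)
            λ (x∈v , x∈u) → d (vars*-lookup⁺ vs i x∈v , vars*-lookup⁺ us i x∈u)
      vs⊇ : ∀ {x} i → x ∈ vars* (vs [ i ]≔ bot) → x ∈ vars* vs
      vs⊇ i x∈ = subst (λ ps → _ ∈ vars* ps) ([]≔-lookup vs i) (vars*-replace⁺ vs i (inj₂ x∈))
      part-linear : ∀ i → Linear (part i)
      part-linear i =
        plug (arg-context f vs i)
          (subst (λ ps → Linear (app f ps)) (sym ([]≔-lookup vs i)) lv)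
          (difference-linear i)
          -- A variable of `us` at `i` that also occurred elsewhere in `vs` would be common to
          -- minuend and subtrahend.
          λ x∈vs → [ id , (λ x∈u → contradiction (vs⊇ i x∈vs , vars*-lookup⁺ us i x∈u) d) ]′
                   ∘ ∈-++⁻ (vars (lookup vs i))
      linear : All Linear (map part (allFin (arity f)))
      linear = List.map⁺ (universal part-linear (allFin (arity f)))
      vars⊆ : vars (sum (map part (allFin (arity f)))) ⊆ˡ vars (app f vs ∖ app f us)
      vars⊆ {x} x∈
        with satisfied (map⁻ {P = λ p → x ∈ vars p} (vars-sum⁻ (map part (allFin (arity f))) x∈))
      ... | i , x∈i with vars*-replace⁻ vs i x∈i
      ...   | inj₂ x∈vs = ∈-++⁺ˡ (vs⊇ i x∈vs)
      ...   | inj₁ x∈d with ∈-++⁻ (vars (lookup vs i)) x∈d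
      ...     | inj₁ x∈v = ∈-++⁺ˡ (vars*-lookup⁺ vs i x∈v)
      ...     | inj₂ x∈u = ∈-++⁺ʳ (vars* vs) (vars*-lookup⁺ us i x∈u)
      reduced : ∀ i → Allᵛ Reduced (vs [ i ]≔ lookup vs i)
      reduced i = subst (Allᵛ Reduced) (sym ([]≔-lookup vs i)) (reduced-args av bv)
      part⇓ : ∀ i {Δ} → Δ ⊢ part i ⇓
      part⇓ i =
        focus (arg-context f vs i) (part-linear i)
          (Vec.lookup⁺ subtractable i (Vec.lookup⁺ (reduced-args av bv) i) (difference-linear i))
          λ r _ → app⇓ (All-replace vs i (reduced i) r)

    -- Recursion is on `v`. After M4 no recursive call is made on the expansion, which is not
    -- smaller than the variable: its summands have a constructor at the head, and `app∖⇓` handles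
    -- those directly.
    pure∖⇓ : ∀ {Γ v} → Additive v → Pure v → Linear (v ∖ u) → Γ ⊢ v ∖ u ⇓
    pure∖⇓ {Γ} (var {x}) var (sub lv lu d) =
      (lin , root (M4 z inj (fresh-∉ Δ) a b) , avoids) ◅⇓
      sum∖⇓ (List.map⁺ (universal (λ c → app (additive c)) (allFin size)))
            (List.map⁺ (universal summand∖⇓ (allFin size))) lin
      where
      -- Covers the surroundings as well as the pattern, for the side condition of M4 and for
      -- `avoids`.
      Δ = Γ ++ vars (var x ∖ u)
      z = fresh Δ
      inj = fresh-injective Δ
      zs : ∀ c → Vec (Pat plain) (ar c)
      zs c = tabulate (λ i → var (z (toℕ i)))
      additive : ∀ c → Allᵛ Additive (zs c)
      additive c = Vec.tabulate⁺ λ _ → var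
      summand∖⇓ : ∀ c {Γ} → Linear (app (con c) (zs c) ∖ u) → Γ ⊢ app (con c) (zs c) ∖ u ⇓
      summand∖⇓ c = app∖⇓ (con c) (additive c) (Vec.tabulate⁺ λ _ → var)
      new : ∀ {y} → y ∈ vars (expand z) → y ∉ Δ
      new y∈ with expand-vars y∈
      ... | i , refl = fresh-∉ Δ i
      lin : Linear (expand z ∖ u)
      lin = sub (expand-linear inj) lu λ (y∈z , y∈u) → new y∈z (∈-++⁺ʳ Γ (there y∈u))
      avoids : Γ ⊢ expand z ∖ u avoids (var x ∖ u)
      avoids y∈Γ y∈ with ∈-++⁻ (vars (expand z)) y∈
      ... | inj₁ y∈z = contradiction (∈-++⁺ˡ y∈Γ) (new y∈z)
      ... | inj₂ y∈u = there y∈u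
    pure∖⇓ (app {f = f} av) (app bv) lin = app∖⇓ f av bv lin
    pure∖⇓ (av + aw) (bv + bw) lin = +∖⇓ av aw lin (pure∖⇓ av bv) (pure∖⇓ aw bw)

    app-subtractable : Subtractable u
    app-subtractable bot        _   = bot∖⇓
    app-subtractable (pure a b) lin = pure∖⇓ a b lin

  mutual
    -- Renamings are carried along because M3 renames the second summand.
    subtract : ∀ {k} {t : Pat k} → Additive t → Pure t → ∀ ρ → Subtractable (rename ρ t)
    subtract var     var     ρ r lin =
      root-step bot (M1 (reduced-additive r)) (λ ()) ◅⇓ reduced⇓ bot
    subtract (app a) (app b) ρ =
      app-subtractable (rename*-additive ρ a) (rename*-pure ρ b) (subtract* a b ρ)
    subtract {t = t₁ + t₂} (a + c) (b + d) ρ {Γ} {v} r (sub lv (l₁ + l₂) dis) =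
      (lin , root (M3 (reduced-additive r) (rename-additive ρ a) (rename-additive ρ c)
                      (σ , σ-injective , refl)) , avoids) ◅⇓
      focus ∖ˡ-context lin (subtract a b ρ r lin₁)
        -- The subtrahend still to be treated is `t₂` renamed by `ρ` and then by `σ`; merging the
        -- two renamings lets the recursive call be on `t₂` itself, a subterm.
        λ {v′} r′ lin′ → subst (λ t → Γ ⊢ v′ ∖ t ⇓) (rename-∘ σ ρ t₂)
          (subtract c d (σ ∘ ρ) r′ (subst (λ t → Linear (v′ ∖ t)) (sym (rename-∘ σ ρ t₂)) lin′))
      where
      u₁ = rename ρ t₁
      u₂ = rename ρ t₂
      Δ = Γ ++ vars (v ∖ (u₁ + u₂))
      σ = fresh Δ
      σ-injective = fresh-injective Δ
      new : ∀ {x} → x ∈ vars (rename σ u₂) → x ∉ Δ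
      new x∈ with ∈-vars-rename⁻ σ u₂ x∈
      ... | y , _ , refl = fresh-∉ Δ y
      old : ∀ {x} → x ∈ vars (v ∖ u₁) → x ∈ vars (v ∖ (u₁ + u₂))
      old = [ ∈-++⁺ˡ , ∈-++⁺ʳ (vars v) ∘ ∈-++⁺ˡ ]′ ∘ ∈-++⁻ (vars v)
      lin₁ : Linear (v ∖ u₁)
      lin₁ = sub lv l₁ λ (x∈v , x∈u) → dis (x∈v , ∈-++⁺ˡ x∈u)
      lin : Linear (v ∖ u₁ ∖ rename σ u₂)
      lin = sub lin₁ (rename-linear σ σ-injective l₂)
                λ (x∈ , x∈u₂) → new x∈u₂ (∈-++⁺ʳ Γ (old x∈))
      avoids : Γ ⊢ v ∖ u₁ ∖ rename σ u₂ avoids (v ∖ (u₁ + u₂))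
      avoids x∈Γ x∈ with ∈-++⁻ (vars (v ∖ u₁)) x∈
      ... | inj₁ x∈₁ = old x∈₁
      ... | inj₂ x∈₂ = contradiction (∈-++⁺ˡ x∈Γ) (new x∈₂)

    subtract* : ∀ {n} {ts : Vec (Pat plain) n} → Allᵛ Additive ts → Allᵛ Pure ts →
                ∀ ρ → Allᵛ Subtractable (rename* ρ ts)
    subtract* []       []       ρ = []
    subtract* (a ∷ as) (b ∷ bs) ρ = subtract a b ρ ∷ subtract* as bs ρ

  reduced-subtractable : ∀ {k} {t : Pat k} → Reduced t → Subtractable t
  reduced-subtractable bot r (sub l _ _) =
    root-step l (M2 (reduced-additive r)) ∈-++⁺ˡ ◅⇓ reduced⇓ r
  reduced-subtractable (pure {t} a b) = subst Subtractable (rename-id t) (subtract a b id)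

  mutual
    normalise : ∀ {Γ k} (p : Pat k) → Linear p → Γ ⊢ p ⇓
    normalise (var x)    lin            = reduced⇓ (pure var var)
    normalise (app f ps) lin@(app ls _) =
      normalise* ps ls (app f) (arg-context f) lin λ rs _ → app⇓ rs
    normalise (p + q)    lin@(l + m)    = +⇓ lin (normalise p l) (normalise q m)
    normalise (p ∖ q)    lin@(sub l m _) =
      focus ∖ˡ-context lin (normalise p l) λ r lin →
      focus ∖ʳ-context lin (normalise q m) λ s → reduced-subtractable s r
    normalise bot        lin            = reduced⇓ bot

    -- Arguments are reduced from left to right. `C` stands for `f` applied to the arguments already
    -- reduced and waiting for the rest, so the tail falls under the same statement.
    normalise* : ∀ {Γ n k} (ps : Vec (Pat plain) n) → Allᵛ Linear ps →
                 (C : Vec (Pat plain) n → Pat k) →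
                 (∀ ps i → Context (λ p → C (ps [ i ]≔ p))) → Linear (C ps) →
                 (∀ {rs} → Allᵛ Reduced rs → Linear (C rs) → Γ ⊢ C rs ⇓) → Γ ⊢ C ps ⇓
    normalise* []       []       C K lin c = c [] lin
    normalise* (p ∷ ps) (l ∷ ls) C K lin c =
      focus (K (p ∷ ps) zero) lin (normalise p l) λ {r} red lin →
      normalise* ps ls (C ∘ (r ∷_)) (λ qs i → K (r ∷ qs) (suc i)) lin (c ∘ (red ∷_))

  ⇒*-linear : ∀ {k} {p q : Pat k} → Linear p → p ⇒* q → Linear q
  ⇒*-linear l ε                  = l
  ⇒*-linear _ ((_ , m , _) ◅ ss) = ⇒*-linear m ss

  normalises : ∀ {k} (p : Pat k) → Linear p → ∃[ r ] (p ⇒* r × Reduced r)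
  normalises p l with normalise {[]} p l
  ... | r , ss , red = r , steps l ss , red
    where
    steps : ∀ {p q} → Linear p → Star ([] ⊢_⇛_) p q → p ⇒* q
    steps l ε                  = ε
    steps l ((m , s , _) ◅ ss) = (l , m , s) ◅ steps m ss

  normalForm-reduced : ∀ {k} {p : Pat k} → Linear p → IsNormalForm _⇒_ p → Reduced p
  normalForm-reduced {p = p} l nf with normalises p l
  ... | _ , ε      , red = red
  ... | _ , s ◅ _ , _   = contradiction (_ , s) nf

  bot-normalForm : ∀ {k} → IsNormalForm _⇒_ (bot {k})
  bot-normalForm (_ , _ , _ , root ())

-- Emptiness, subsumption and the normal form `bot`

module Proof (S : Signature) where
  open Patterns S
  open Semantics S
  open Contexts S
  open Normalisation S

  reduced-empty : ∀ {k} {p : Pat k} → Reduced p → Empty ⟦ p ⟧ → p ≡ bot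
  reduced-empty bot        _ = refl
  reduced-empty (pure a b) e = contradiction (inhabited a b .proj₂) (e _)

  ↓≡bot⇔empty : ∀ {k} (p : Pat k) → Linear p → p ↓≡ bot ⇔ Empty ⟦ p ⟧
  ↓≡bot⇔empty p l = mk⇔ (λ (p⇒*bot , _) _ → proj₁ (⇒*-sound p⇒*bot)) from
    where
    -- Serves twice: for the reduct found by normalisation, and for an arbitrary normal form in the
    -- uniqueness clause.
    reduct≡bot : Empty ⟦ p ⟧ → ∀ {r} → p ⇒* r → Reduced r → r ≡ bot
    reduct≡bot e p⇒*r red = reduced-empty red λ t → e t ∘ proj₂ (⇒*-sound p⇒*r)
    from : Empty ⟦ p ⟧ → p ↓≡ bot
    from e with normalises p l
    ... | r , p⇒*r , red =
      subst (p ⇒*_) (reduct≡bot e p⇒*r red) p⇒*r , bot-normalForm ,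
      λ p⇒*s nf → reduct≡bot e p⇒*s (normalForm-reduced (⇒*-linear l p⇒*s) nf)

  subsumed⇔empty : ∀ {k} (p : Pat k) {ps qs} → Pointwise Variant ps qs →
                   p SubsumedBy ps ⇔ Empty ⟦ p ∖ sum qs ⟧
  subsumed⇔empty p {ps} {qs} vs = mk⇔
    (λ p⊆ps t (h , ¬h) → ¬h (⟦sum⟧⁺ qs (Any-variant⁺ vs (p⊆ps h))))
    (λ e {t} h → Any-variant⁻ vs
       -- Emptiness of the difference says only that `t` is not outside the sum; decidability turns
       -- this into membership.
       (⟦sum⟧⁻ qs (decidable-stable (⟦ sum qs ⟧? t) λ ¬h → e t (h , ¬h))))

-- The `ps` may share variables with `p`, so the difference is formed with renamed copies `qs` that
-- make it linear; renaming leaves the semantics unchanged.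
proposition3p3 : (S : Signature) → let open Patterns S in
    ∀ {k} (p : Pat k) (ps qs : List (Pat k)) →
    Linear p → All Linear ps →
    Pointwise Variant ps qs → Linear (p ∖ sum qs) →
    p SubsumedBy ps ⇔ (p ∖ sum qs) ↓≡ bot
proposition3p3 S p ps qs _ _ vs lin =
  ⇔-trans (Proof.subsumed⇔empty S p vs) (⇔-sym (Proof.↓≡bot⇔empty S _ lin))
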